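{- Given a connected graph $G(V,E)$ with lightest tone $lt_G=\frac{1}{k}$, where $k$ is a natural number, and $f$ a maximum contrast greyscale of $G$, a $(k+1)$-colouring of $G$ is obtained from $f$.
   Context: Graphs are finite, undirected and simple. A greyscale of $G(V,E)$ is a map $f:V\to[0,1]$ such that the values $0$ and $1$ belong to $\mathrm{Im}(f)$. For each edge $e=\{u,v\}\in E$ put $\widehat f(e)=|f(u)-f(v)|$. The contrast vector $cont(G,f)$ is the vector of all values $\widehat f(e)$, $e\in E$, listed in ascending order. Contrast vectors are compared in the lexicographical order, and $cont_{max}(G)$ denotes the maximum of $cont(G,f)$ over all greyscales $f$ of $G$. A maximum contrast greyscale of $G$ is a greyscale $f$ with $cont(G,f)=cont_{max}(G)$. The lightest tone $lt_G$ is the first component of $cont_{max}(G)$. A $(k+1)$-colouring of $G$ is a colouring of the vertices of $G$ with $k+1$ colours in which adjacent vertices always have different colours. -}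

module Defs where

open import Data.Nat.Base as ℕ using (ℕ; suc)
import Data.Nat.Properties as ℕ
open import Data.Integer.Base as ℤ using (ℤ; +_)
import Data.Integer.Tactic.RingSolver as ℤ-Solver
open import Data.Rational.Base as ℚ using (ℚ; 0ℚ; 1ℚ)
import Data.Rational.Properties as ℚ
open import Data.Rational.Solver using (module +-*-Solver)
open import Data.Rational.Unnormalised.Base as ℚᵘ using (mkℚᵘ)
import Data.Rational.Unnormalised.Properties as ℚᵘ
open import Data.Fin.Base using (Fin)
open import Data.Fin.Properties using (_<?_)
open import Data.List.Base
  using (List; []; _∷_; map; foldr; filter; allFin; cartesianProduct)
open import Data.List.Relation.Binary.Pointwise using (Pointwise)
open import Data.List.Relation.Binary.Lex.Strict using (Lex-<)
open import Data.Product.Base using (∃-syntax; _×_; _,_)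
open import Data.Sum.Base using (inj₁; inj₂)
open import Level using (0ℓ)
open import Relation.Binary.Core using (Rel)
open import Relation.Binary.Definitions using (Decidable; Symmetric)
open import Relation.Binary.Construct.Closure.ReflexiveTransitive using (Star)
open import Relation.Binary.PropositionalEquality
  using (_≡_; _≢_; refl; sym; trans; cong; cong₂; subst)
open import Relation.Nullary using (¬_)
open import Relation.Nullary.Decidable using (_×-dec_)

------------------------------------------------------------------------
-- Real numbers: Bishop's regular sequences of rationals, the n-th term
-- being an approximation with error at most ε n = 1/(n+1).

ε : ℕ → ℚ
ε n = + 1 ℚ./ suc n

record ℝ : Set where
  constructor mkℝ
  field
    seq     : ℕ → ℚ
    regular : ∀ m n → ℚ.∣ seq m ℚ.- seq n ∣ ℚ.≤ ε m ℚ.+ ε n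

open ℝ public

infix 4 _<_ _≤_ _≈_

-- x < y when, at some precision, the upper bound seq x n + ε n for x
-- lies below the lower bound seq y n - ε n for y.
_<_ : Rel ℝ 0ℓ
x < y = ∃[ n ] seq x n ℚ.+ ε n ℚ.< seq y n ℚ.- ε n

_≤_ : Rel ℝ 0ℓ
x ≤ y = ¬ (y < x)

_≈_ : Rel ℝ 0ℓ
x ≈ y = x ≤ y × y ≤ x

0≤ε : ∀ n → 0ℚ ℚ.≤ ε n
0≤ε n = ℚ.nonNegative⁻¹ (ε n) {{ℚ.normalize-nonNeg 1 (suc n)}}

ε-half : ∀ n → ε (suc (n ℕ.+ n)) ℚ.+ ε (suc (n ℕ.+ n)) ≡ ε n
ε-half n = ℚ.toℚᵘ-injective (begin
    ℚ.toℚᵘ (ε d ℚ.+ ε d)             ≈⟨ ℚ.toℚᵘ-homo-+ (ε d) (ε d) ⟩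
    ℚ.toℚᵘ (ε d) ℚᵘ.+ ℚ.toℚᵘ (ε d)   ≈⟨ ℚᵘ.+-cong (toᵘ d) (toᵘ d) ⟩
    mkℚᵘ (+ 1) d ℚᵘ.+ mkℚᵘ (+ 1) d   ≈⟨ ℚᵘ.*≡* cross ⟩
    mkℚᵘ (+ 1) n                     ≈⟨ toᵘ n ⟨
    ℚ.toℚᵘ (ε n)                     ∎)
  where
  open import Relation.Binary.Reasoning.Setoid ℚᵘ.≃-setoid
  d : ℕ
  d = suc (n ℕ.+ n)
  toᵘ : ∀ m → ℚ.toℚᵘ (ε m) ℚᵘ.≃ mkℚᵘ (+ 1) m
  toᵘ m = ℚ.toℚᵘ-fromℚᵘ (mkℚᵘ (+ 1) m)
  Cross : ℤ → Set
  Cross D = (+ 1 ℤ.* D ℤ.+ + 1 ℤ.* D) ℤ.* + suc n ≡ + 1 ℤ.* (D ℤ.* D)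
  ring : ∀ N → (+ 1 ℤ.* (N ℤ.+ N) ℤ.+ + 1 ℤ.* (N ℤ.+ N)) ℤ.* N
             ≡ + 1 ℤ.* ((N ℤ.+ N) ℤ.* (N ℤ.+ N))
  ring = ℤ-Solver.solve-∀
  cross : Cross (+ suc d)
  cross = subst Cross (cong (λ m → + suc m) (ℕ.+-suc n n)) (ring (+ suc n))

-- |a - b| ≤ e as a pair of one-sided bounds
Close : ℚ → ℚ → ℚ → Set
Close e a b = a ℚ.≤ b ℚ.+ e × b ℚ.≤ a ℚ.+ e

p≤∣p∣ : ∀ p → p ℚ.≤ ℚ.∣ p ∣
p≤∣p∣ p with ℚ.≤-total 0ℚ p
... | inj₁ 0≤p = ℚ.≤-reflexive (sym (ℚ.0≤p⇒∣p∣≡p 0≤p))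
... | inj₂ p≤0 = ℚ.≤-trans p≤0 (ℚ.0≤∣p∣ p)

-p≤∣p∣ : ∀ p → ℚ.- p ℚ.≤ ℚ.∣ p ∣
-p≤∣p∣ p = subst (ℚ.- p ℚ.≤_) (ℚ.∣-p∣≡∣p∣ p) (p≤∣p∣ (ℚ.- p))

∣∣-lub : ∀ {p e} → p ℚ.≤ e → ℚ.- p ℚ.≤ e → ℚ.∣ p ∣ ℚ.≤ e
∣∣-lub {p} p≤e -p≤e with ℚ.∣p∣≡p∨∣p∣≡-p p
... | inj₁ eq = subst (ℚ._≤ _) (sym eq) p≤e
... | inj₂ eq = subst (ℚ._≤ _) (sym eq) -p≤e

a≡b+[a-b] : ∀ a b → a ≡ b ℚ.+ (a ℚ.- b)
a≡b+[a-b] = solve 2 (λ a b → a := b :+ (a :- b)) refl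
  where open +-*-Solver

b≡a-[a-b] : ∀ a b → b ≡ a ℚ.- (a ℚ.- b)
b≡a-[a-b] = solve 2 (λ a b → b := a :- (a :- b)) refl
  where open +-*-Solver

[b+e]-b≡e : ∀ b e → (b ℚ.+ e) ℚ.- b ≡ e
[b+e]-b≡e = solve 2 (λ b e → (b :+ e) :- b := e) refl
  where open +-*-Solver

-[a-b]≡b-a : ∀ a b → ℚ.- (a ℚ.- b) ≡ b ℚ.- a
-[a-b]≡b-a = solve 2 (λ a b → :- (a :- b) := b :- a) refl
  where open +-*-Solver

-[b+e]+e≡-b : ∀ b e → ℚ.- (b ℚ.+ e) ℚ.+ e ≡ ℚ.- b
-[b+e]+e≡-b = solve 2 (λ b e → :- (b :+ e) :+ e := :- b) refl
  where open +-*-Solver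

[x-y]-[z-w] : ∀ x y z w → (x ℚ.- y) ℚ.- (z ℚ.- w) ≡ (x ℚ.- z) ℚ.- (y ℚ.- w)
[x-y]-[z-w] = solve 4 (λ x y z w → (x :- y) :- (z :- w) := (x :- z) :- (y :- w)) refl
  where open +-*-Solver

[a+b]+[a+b] : ∀ a b → (a ℚ.+ b) ℚ.+ (a ℚ.+ b) ≡ (a ℚ.+ a) ℚ.+ (b ℚ.+ b)
[a+b]+[a+b] = solve 2 (λ a b → (a :+ b) :+ (a :+ b) := (a :+ a) :+ (b :+ b)) refl
  where open +-*-Solver

toClose : ∀ {e a b} → ℚ.∣ a ℚ.- b ∣ ℚ.≤ e → Close e a b
toClose {e} {a} {b} le =
  subst (ℚ._≤ b ℚ.+ e) (sym (a≡b+[a-b] a b))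
    (ℚ.+-monoʳ-≤ b (ℚ.≤-trans (p≤∣p∣ (a ℚ.- b)) le)) ,
  subst (ℚ._≤ a ℚ.+ e) (sym (b≡a-[a-b] a b))
    (ℚ.+-monoʳ-≤ a (ℚ.≤-trans (-p≤∣p∣ (a ℚ.- b)) le))

fromClose : ∀ {e a b} → Close e a b → ℚ.∣ a ℚ.- b ∣ ℚ.≤ e
fromClose {e} {a} {b} (a≤ , b≤) = ∣∣-lub
  (subst (a ℚ.- b ℚ.≤_) ([b+e]-b≡e b e) (ℚ.+-monoˡ-≤ (ℚ.- b) a≤))
  (subst (ℚ._≤ e) (sym (-[a-b]≡b-a a b))
    (subst (b ℚ.- a ℚ.≤_) ([b+e]-b≡e a e) (ℚ.+-monoˡ-≤ (ℚ.- a) b≤)))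

neg-shift : ∀ {e a b} → a ℚ.≤ b ℚ.+ e → ℚ.- b ℚ.≤ ℚ.- a ℚ.+ e
neg-shift {e} {a} {b} a≤ =
  subst (ℚ._≤ ℚ.- a ℚ.+ e) (-[b+e]+e≡-b b e) (ℚ.+-monoˡ-≤ e (ℚ.neg-antimono-≤ a≤))

∣∣-shift : ∀ {e a b} → Close e a b → ℚ.∣ a ∣ ℚ.≤ ℚ.∣ b ∣ ℚ.+ e
∣∣-shift {e} {a} {b} (a≤ , b≤) = ∣∣-lub
  (ℚ.≤-trans a≤ (ℚ.+-monoˡ-≤ e (p≤∣p∣ b)))
  (ℚ.≤-trans (neg-shift b≤) (ℚ.+-monoˡ-≤ e (-p≤∣p∣ b)))

⊓-shift : ∀ {e} a b c d → a ℚ.≤ c ℚ.+ e → b ℚ.≤ d ℚ.+ e → a ℚ.⊓ b ℚ.≤ (c ℚ.⊓ d) ℚ.+ e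
⊓-shift {e} a b c d a≤ b≤ =
  subst (a ℚ.⊓ b ℚ.≤_) (sym (ℚ.mono-≤-distrib-⊓ (ℚ.+-monoˡ-≤ e) c d)) (ℚ.⊓-mono-≤ a≤ b≤)

⊔-shift : ∀ {e} a b c d → a ℚ.≤ c ℚ.+ e → b ℚ.≤ d ℚ.+ e → a ℚ.⊔ b ℚ.≤ (c ℚ.⊔ d) ℚ.+ e
⊔-shift {e} a b c d a≤ b≤ =
  subst (a ℚ.⊔ b ℚ.≤_) (sym (ℚ.mono-≤-distrib-⊔ (ℚ.+-monoˡ-≤ e) c d)) (ℚ.⊔-mono-≤ a≤ b≤)

close : ∀ x m n → Close (ε m ℚ.+ ε n) (seq x m) (seq x n)
close x m n = toClose (regular x m n)

fromℚ : ℚ → ℝ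
fromℚ q = mkℝ (λ _ → q) λ m n →
  subst (ℚ._≤ ε m ℚ.+ ε n) (sym (cong ℚ.∣_∣ (ℚ.+-inverseʳ q)))
    (ℚ.+-mono-≤ (0≤ε m) (0≤ε n))

0ℝ 1ℝ : ℝ
0ℝ = fromℚ 0ℚ
1ℝ = fromℚ 1ℚ

infixl 6 _-_
infixl 7 _⊓_
infixl 6 _⊔_

-- Term n reads its arguments at index 2n+1, where the two errors
-- 1/(2n+2) add up to 1/(n+1).
_-_ : ℝ → ℝ → ℝ
x - y = mkℝ (λ n → seq x (d n) ℚ.- seq y (d n)) λ m n →
    subst (ℚ._≤ ε m ℚ.+ ε n)
      (sym (cong ℚ.∣_∣ ([x-y]-[z-w] (seq x (d m)) (seq y (d m)) (seq x (d n)) (seq y (d n)))))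
      (ℚ.≤-trans (ℚ.∣p-q∣≤∣p∣+∣q∣ (seq x (d m) ℚ.- seq x (d n)) (seq y (d m) ℚ.- seq y (d n)))
        (ℚ.≤-trans (ℚ.+-mono-≤ (regular x (d m) (d n)) (regular y (d m) (d n)))
          (ℚ.≤-reflexive (trans ([a+b]+[a+b] (ε (d m)) (ε (d n)))
                                (cong₂ ℚ._+_ (ε-half m) (ε-half n))))))
  where
  d : ℕ → ℕ
  d n = suc (n ℕ.+ n)

∣_∣ : ℝ → ℝ
∣ x ∣ = mkℝ (λ n → ℚ.∣ seq x n ∣) λ m n →
  let p , q = close x m n in
  fromClose {a = ℚ.∣ seq x m ∣} (∣∣-shift (p , q) , ∣∣-shift (q , p))

_⊓_ : ℝ → ℝ → ℝ
x ⊓ y = mkℝ (λ n → seq x n ℚ.⊓ seq y n) λ m n →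
  let p , q = close x m n ; r , s = close y m n in
  fromClose {a = seq x m ℚ.⊓ seq y m}
    ( ⊓-shift (seq x m) (seq y m) (seq x n) (seq y n) p r
    , ⊓-shift (seq x n) (seq y n) (seq x m) (seq y m) q s )

_⊔_ : ℝ → ℝ → ℝ
x ⊔ y = mkℝ (λ n → seq x n ℚ.⊔ seq y n) λ m n →
  let p , q = close x m n ; r , s = close y m n in
  fromClose {a = seq x m ℚ.⊔ seq y m}
    ( ⊔-shift (seq x m) (seq y m) (seq x n) (seq y n) p r
    , ⊔-shift (seq x n) (seq y n) (seq x m) (seq y m) q s )

-- Insertion sort in ascending order.  The order on ℝ is not decidable,
-- so an insertion step puts min(x,y) first and carries max(x,y) onwards.
insert : ℝ → List ℝ → List ℝ
insert x []       = x ∷ []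
insert x (y ∷ ys) = x ⊓ y ∷ insert (x ⊔ y) ys

sort : List ℝ → List ℝ
sort = foldr insert []

infix 4 _≋_ _≤ₗₑₓ_

_≋_ : Rel (List ℝ) 0ℓ
_≋_ = Pointwise _≈_

-- Stated by negation, like ≤ on ℝ: Lex-≤ would demand deciding, at each
-- position, between x < y and x ≈ y.
_≤ₗₑₓ_ : Rel (List ℝ) 0ℓ
xs ≤ₗₑₓ ys = ¬ (Lex-< _≈_ _<_ ys xs)

------------------------------------------------------------------------
-- Graphs

record Graph (n : ℕ) : Set₁ where
  infix 4 _~_ _~?_
  field
    _~_      : Rel (Fin n) 0ℓ
    _~?_     : Decidable _~_
    ~-sym    : Symmetric _~_
    ~-irrefl : ∀ {v} → ¬ (v ~ v)

module _ {n : ℕ} (G : Graph n) where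
  open Graph G

  Connected : Set
  Connected = ∀ u v → Star _~_ u v

  -- An edge {u,v} is listed once, as the pair with u < v.
  edges : List (Fin n × Fin n)
  edges = filter (λ (u , v) → (u <? v) ×-dec (u ~? v))
                 (cartesianProduct (allFin n) (allFin n))

  IsColouring : ∀ {m} → (Fin n → Fin m) → Set
  IsColouring c = ∀ {u v} → u ~ v → c u ≢ c v

  record IsGreyscale (f : Fin n → ℝ) : Set where
    field
      nonneg  : ∀ v → 0ℝ ≤ f v
      ≤one    : ∀ v → f v ≤ 1ℝ
      0∈image : ∃[ v ] f v ≈ 0ℝ
      1∈image : ∃[ v ] f v ≈ 1ℝ

  contrast : (Fin n → ℝ) → Fin n × Fin n → ℝ
  contrast f (u , v) = ∣ f u - f v ∣

  cont : (Fin n → ℝ) → List ℝ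
  cont f = sort (map (contrast f) edges)

  -- m is cont_max(G), the lexicographic maximum of the contrast vectors.
  record IsContMax (m : List ℝ) : Set where
    field
      attained : ∃[ f ] IsGreyscale f × cont f ≋ m
      maximal  : ∀ f → IsGreyscale f → cont f ≤ₗₑₓ m

  IsMaximumContrastGreyscale : (Fin n → ℝ) → Set
  IsMaximumContrastGreyscale f = IsGreyscale f × IsContMax (cont f)

  IsLightestTone : ℝ → Set
  IsLightestTone t = ∃[ x ] ∃[ xs ] IsContMax (x ∷ xs) × x ≈ t

  -- A colouring obtained from f: the colour of a vertex depends only on
  -- its tone, i.e. the colouring factors through f : V → Im(f).
  IsObtainedFrom : ∀ {m} → (Fin n → ℝ) → (Fin n → Fin m) → Set
  IsObtainedFrom f c = ∀ u v → f u ≈ f v → c u ≡ c v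

{-# OPTIONS --safe #-}
-- Dividing [0,1] into k + 1 cells, each shorter than the lightest tone 1/k,
-- separates adjacent vertices, so the cell containing f v may serve as the
-- colour of v.  The floor of k · f v is not computable from a real f v; but
-- k + 1 cells of length 1/k cover more than is needed, and this slack leaves
-- room to shift the cell boundaries away from the finitely many tones.
-- Concretely, tones are rounded to a grid a v of step e = 1/(k(p + 2)), cells
-- consist of p grid points, and the boundaries avoid all tones when
-- p ∤ a v + s for all v, which by the pigeonhole principle holds for
-- some s ≤ n.
module Submission where

open import Algebra.Properties.Monoid.Mult using (×-homo-+)
open import Data.Fin.Base using (Fin; toℕ; fromℕ<)
import Data.Fin.Properties as Fin
open import Data.Integer.Base using (+_)
import Data.Integer.Base as ℤ
import Data.Integer.Properties as ℤ
import Data.Integer.Tactic.RingSolver as ℤ-Solver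
open import Data.List.Base using (List; []; _∷_)
open import Data.List.Membership.Propositional using (_∈_)
open import Data.List.Membership.Propositional.Properties
  using (∈-filter⁺; ∈-cartesianProduct⁺; ∈-allFin; ∈-map⁺)
open import Data.List.Relation.Binary.Lex.Strict using (Lex-<; this)
open import Data.List.Relation.Binary.Pointwise using (_∷_)
open import Data.List.Relation.Unary.Any using (here; there)
open import Data.Nat.Base as ℕ using (ℕ; zero; suc; NonZero)
import Data.Nat.Properties as ℕ
open import Data.Nat.Divisibility using (_∣_; _∣?_; divides; ∣m+n∣m⇒∣n; >⇒∤)
open import Data.Nat.DivMod
  using (/-monoˡ-≤; m/n*n≤m; m<n*o⇒m/o<n; m*n/n≡m; m/n≡1+[m∸n]/n)
open import Data.Nat.Solver using () renaming (module +-*-Solver to ℕ-Solver)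
open import Data.Product.Base using (Σ-syntax; ∃-syntax; _×_; _,_; proj₁; proj₂)
open import Data.Rational.Base as ℚ using (ℚ; 0ℚ; 1ℚ; _/_)
import Data.Rational.Properties as ℚ
open import Data.Rational.Solver using (module +-*-Solver)
open import Data.Rational.Unnormalised.Base as ℚᵘ using (mkℚᵘ)
import Data.Rational.Unnormalised.Properties as ℚᵘ
open import Data.Sum.Base using (_⊎_; inj₁; inj₂; [_,_]′)
open import Relation.Binary.Definitions using (tri<; tri≈; tri>)
open import Relation.Binary.PropositionalEquality
  using (_≡_; _≢_; refl; sym; trans; cong; cong₂; subst; module ≡-Reasoning)
open import Relation.Nullary using (¬_; yes; no; contradiction)
open import Relation.Nullary.Decidable using (¬?; decidable-stable)
open import Defs

open import Algebra.Definitions.RawMonoid ℚ.+-0-rawMonoid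
  using () renaming (_×_ to _·_)

-- Rational inequalities and unit fractions

<⇒≱ : ∀ {p q} → p ℚ.< q → ¬ (q ℚ.≤ p)
<⇒≱ p<q q≤p = ℚ.<-irrefl refl (ℚ.<-≤-trans p<q q≤p)

-- Reduces linear arithmetic over ℚ to identities for the ring solver.
≤-by-difference : ∀ {x y a b} → y ℚ.- x ≡ b ℚ.- a → x ℚ.≤ y → a ℚ.≤ b
≤-by-difference {x} {y} {a} {b} eq x≤y = begin
  a                    ≡⟨ [b+e]-b≡e x a ⟨
  x ℚ.+ a ℚ.- x        ≤⟨ ℚ.+-monoˡ-≤ (ℚ.- x) (ℚ.+-monoˡ-≤ a x≤y) ⟩
  y ℚ.+ a ℚ.- x        ≡⟨ solve 3 (λ x y a → y :+ a :- x := a :+ (y :- x)) refl x y a ⟩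
  a ℚ.+ (y ℚ.- x)      ≡⟨ cong (a ℚ.+_) eq ⟩
  a ℚ.+ (b ℚ.- a)      ≡⟨ a≡b+[a-b] b a ⟨
  b                    ∎
  where
  open ℚ.≤-Reasoning
  open +-*-Solver

<-by-difference : ∀ {x y a b} → y ℚ.- x ≡ b ℚ.- a → x ℚ.< y → a ℚ.< b
<-by-difference {x} {y} {a} {b} eq x<y = ℚ.≰⇒> λ b≤a →
  <⇒≱ x<y (≤-by-difference (trans (sym (-[a-b]≡b-a b a))
    (trans (cong ℚ.-_ (sym eq)) (-[a-b]≡b-a y x))) b≤a)

toᵘ-/ : ∀ i m → ℚ.toℚᵘ (i / suc m) ℚᵘ.≃ mkℚᵘ i m
toᵘ-/ i m = ℚ.toℚᵘ-fromℚᵘ (mkℚᵘ i m)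

ε>0 : ∀ n → 0ℚ ℚ.< ε n
ε>0 n = ℚ.positive⁻¹ (ε n) {{ℚ.normalize-pos 1 (suc n)}}

-- In lowest terms a positive numerator is at least 1, so the reciprocal of the denominator is a
-- lower bound.
ε-archimedean : ∀ {d} → 0ℚ ℚ.< d → ∃[ m ] ε m ℚ.≤ d
ε-archimedean {ℚ.mkℚ (+ zero) _ _}     (ℚ.*<* (ℤ.+<+ ()))
ε-archimedean {ℚ.mkℚ ℤ.-[1+ _ ] _ _}   (ℚ.*<* ())
ε-archimedean d@{ℚ.mkℚ (+ suc p) m _} _ = m , ℚ.toℚᵘ-cancel-≤
  (ℚᵘ.≤-respˡ-≃ (ℚᵘ.≃-sym (toᵘ-/ (+ 1) m))
    (ℚᵘ.*≤* (ℤ.*-monoʳ-≤-nonNeg (+ suc m) {+ 1} {+ suc p} (ℤ.+≤+ (ℕ.s≤s ℕ.z≤n)))))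

·-ε : ∀ n m → n · ε m ≡ + n / suc m
·-ε zero    m = ℚ.fromℚᵘ-cong {mkℚᵘ (+ 0) 0} {mkℚᵘ (+ 0) m} (ℚᵘ.*≡* refl)
·-ε (suc n) m = ℚ.toℚᵘ-injective (begin
    ℚ.toℚᵘ (ε m ℚ.+ n · ε m)                 ≡⟨ cong (λ x → ℚ.toℚᵘ (ε m ℚ.+ x)) (·-ε n m) ⟩
    ℚ.toℚᵘ (ε m ℚ.+ + n / suc m)             ≈⟨ ℚ.toℚᵘ-homo-+ (ε m) (+ n / suc m) ⟩
    ℚ.toℚᵘ (ε m) ℚᵘ.+ ℚ.toℚᵘ (+ n / suc m)   ≈⟨ ℚᵘ.+-cong (toᵘ-/ (+ 1) m) (toᵘ-/ (+ n) m) ⟩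
    mkℚᵘ (+ 1) m ℚᵘ.+ mkℚᵘ (+ n) m           ≈⟨ ℚᵘ.*≡* (ring (+ suc m) (+ n)) ⟩
    mkℚᵘ (+ suc n) m                         ≈⟨ toᵘ-/ (+ suc n) m ⟨
    ℚ.toℚᵘ (+ suc n / suc m)                 ∎)
  where
  open import Relation.Binary.Reasoning.Setoid ℚᵘ.≃-setoid
  ring : ∀ d x → (+ 1 ℤ.* d ℤ.+ x ℤ.* d) ℤ.* d ≡ (+ 1 ℤ.+ x) ℤ.* (d ℤ.* d)
  ring = ℤ-Solver.solve-∀

-- Used to express both 1 and `1/k` as whole numbers of grid steps.
·-ε-scale : ∀ q j m → suc m ≡ suc j ℕ.* q → q · ε m ≡ ε j
·-ε-scale q j m eq = trans (·-ε q m)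
  (ℚ.fromℚᵘ-cong {mkℚᵘ (+ q) m} {mkℚᵘ (+ 1) j} (ℚᵘ.*≡* (begin
    + q ℤ.* + suc j      ≡⟨ ℤ.*-comm (+ q) (+ suc j) ⟩
    + suc j ℤ.* + q      ≡⟨ ℤ.pos-* (suc j) q ⟨
    + (suc j ℕ.* q)      ≡⟨ cong +_ eq ⟨
    + suc m              ≡⟨ ℤ.*-identityˡ (+ suc m) ⟨
    + 1 ℤ.* + suc m      ∎)))
  where open ≡-Reasoning

-- Real numbers

≤⇒seq : ∀ {x y} → x ≤ y → ∀ n → seq x n ℚ.- ε n ℚ.≤ seq y n ℚ.+ ε n
≤⇒seq x≤y n = ℚ.≮⇒≥ λ lt → x≤y (n , lt)

<-≤-trans : ∀ {x y z} → x < y → y ≤ z → x < z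
<-≤-trans {x} {y} {z} (n , x<y) y≤z = m , <-by-difference difference
    (ℚ.+-mono-≤-< (ℚ.+-mono-≤ xₘ≤xₙ yₙ≤yₘ) (ℚ.+-mono-≤-< (≤⇒seq {y} {z} y≤z m) 6e<gap))
  where
  open +-*-Solver
  half : ℕ → ℕ
  half n = suc (n ℕ.+ n)
  gap : ℚ
  gap = seq y n ℚ.- ε n ℚ.- (seq x n ℚ.+ ε n)
  gap>0 : 0ℚ ℚ.< gap
  gap>0 = <-by-difference (solve 2 (λ a b → b :- a := b :- a :- con 0ℚ) refl
    (seq x n ℚ.+ ε n) (seq y n ℚ.- ε n)) x<y
  D m : ℕ
  D = proj₁ (ε-archimedean gap>0)
  -- Moving from index `n` to `m` costs `2e`, the bound `y ≤ z` another `2e`, and the margins in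
  -- `x < z` the last `2e`; three halvings give `8e ≤ gap`.
  m = half (half (half D))
  e 2e 4e : ℚ
  e = ε m
  2e = e ℚ.+ e
  4e = 2e ℚ.+ 2e
  4e≡ : 4e ≡ ε (half D)
  4e≡ = trans (cong₂ ℚ._+_ (ε-half (half (half D))) (ε-half (half (half D)))) (ε-half (half D))
  8e≡ : 4e ℚ.+ 4e ≡ ε D
  8e≡ = trans (cong₂ ℚ._+_ 4e≡ 4e≡) (ε-half D)
  2e>0 : 0ℚ ℚ.< 2e
  2e>0 = ℚ.+-mono-< (ε>0 m) (ε>0 m)
  6e<gap : 4e ℚ.+ 2e ℚ.< gap
  6e<gap = ℚ.<-≤-trans
    (<-by-difference (solve 1 (λ e → e :- con 0ℚ :=
        (e :+ e :+ (e :+ e)) :- (e :+ e :+ e)) refl 2e) 2e>0)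
    (subst (ℚ._≤ gap) (sym 8e≡) (proj₂ (ε-archimedean gap>0)))
  xₘ≤xₙ : seq x m ℚ.≤ seq x n ℚ.+ (e ℚ.+ ε n)
  xₘ≤xₙ = proj₁ (close x m n)
  yₙ≤yₘ : seq y n ℚ.≤ seq y m ℚ.+ (e ℚ.+ ε n)
  yₙ≤yₘ = proj₂ (close y m n)
  difference : _ ≡ (seq z m ℚ.- e) ℚ.- (seq x m ℚ.+ e)
  difference = solve 7 (λ xm xn ym yn zm e en →
      (xn :+ (e :+ en) :+ (ym :+ (e :+ en)) :+ (zm :+ e :+ (yn :- en :- (xn :+ en))))
      :- (xm :+ yn :+ (ym :- e :+ ((e :+ e) :+ (e :+ e) :+ (e :+ e))))
      := (zm :- e) :- (xm :+ e))
    refl (seq x m) (seq x n) (seq y m) (seq y n) (seq z m) e (ε n)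

-- The first component of a sorted list

-- The comparison is termwise because `⊓` acts termwise on sequences; a strict inequality then
-- carries over at the same index.
data HeadBelow (z : ℝ) : List ℝ → Set where
  head≤ : ∀ {y ys} → (∀ n → seq y n ℚ.≤ seq z n) → HeadBelow z (y ∷ ys)

insert-headBelow-new : ∀ z xs → HeadBelow z (insert z xs)
insert-headBelow-new z []       = head≤ λ n → ℚ.≤-refl
insert-headBelow-new z (x ∷ xs) = head≤ λ n → ℚ.p⊓q≤p (seq z n) (seq x n)

insert-headBelow-old : ∀ {z xs} x → HeadBelow z xs → HeadBelow z (insert x xs)
insert-headBelow-old x (head≤ {y} y≤z) =
  head≤ λ n → ℚ.≤-trans (ℚ.p⊓q≤q (seq x n) (seq y n)) (y≤z n)

sort-headBelow : ∀ {z xs} → z ∈ xs → HeadBelow z (sort xs)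
sort-headBelow {z} {_ ∷ xs} (here refl)  = insert-headBelow-new z (sort xs)
sort-headBelow {z} {x ∷ _}  (there z∈xs) = insert-headBelow-old x (sort-headBelow z∈xs)

-- The chain `y ≤ z < t ≤ x ≤ y′` between the heads settles the comparison at the first component.
headBelow⇒lex : ∀ {z t x m ys xs} → HeadBelow z m → z < t → t ≤ x → ys ≋ x ∷ xs →
                Lex-< _≈_ _<_ m ys
headBelow⇒lex {z} {t} {x} (head≤ {y} y≤z) (n , z<t) t≤x (_∷_ {x = y′} (_ , x≤y′) _) =
  this (<-≤-trans {y} {x} {y′} (<-≤-trans {y} {t} {x} y<t t≤x) x≤y′)
  where
  y<t : y < t
  y<t = n , ℚ.≤-<-trans (ℚ.+-monoˡ-≤ (ε n) (y≤z n)) z<t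

-- Rounding to a grid of step e

·-nonNeg : ∀ {e} → 0ℚ ℚ.≤ e → ∀ n → 0ℚ ℚ.≤ n · e
·-nonNeg 0≤e zero    = ℚ.≤-refl
·-nonNeg 0≤e (suc n) = ℚ.+-mono-≤ 0≤e (·-nonNeg 0≤e n)

·-monoˡ-≤ : ∀ {e a b} → 0ℚ ℚ.≤ e → a ℕ.≤ b → a · e ℚ.≤ b · e
·-monoˡ-≤ {b = b} 0≤e ℕ.z≤n   = ·-nonNeg 0≤e b
·-monoˡ-≤ {e} 0≤e (ℕ.s≤s a≤b) = ℚ.+-monoʳ-≤ e (·-monoˡ-≤ 0≤e a≤b)

·-cancelʳ-< : ∀ {e} a b → 0ℚ ℚ.≤ e → a · e ℚ.< b · e → a ℕ.< b
·-cancelʳ-< a b 0≤e lt = ℕ.≰⇒> λ b≤a → <⇒≱ lt (·-monoˡ-≤ 0≤e b≤a)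

floor : ∀ {e y} b → 0ℚ ℚ.≤ y → y ℚ.< b · e → ∃[ a ] a · e ℚ.≤ y × y ℚ.< suc a · e
floor zero 0≤y y<0 = contradiction 0≤y (<⇒≱ y<0)
floor {e} {y} (suc b) 0≤y y<1+b with y ℚ.<? b · e
... | yes y<b = floor b 0≤y y<b
... | no  y≮b = b , ℚ.≮⇒≥ y≮b , y<1+b

-- The shift by one step makes q + e nonnegative for an approximation q,
-- with error at most e, of a nonnegative real.
record Rounds (e q : ℚ) (a : ℕ) : Set where
  constructor _,_
  field
    lower : a · e ℚ.≤ q ℚ.+ e
    upper : q ℚ.+ e ℚ.< suc a · e

-- The error `e` in `p ≤ q + e` is one grid step, so rounding can reverse the order by one grid
-- point; `p∤x⇒x/p≤y/p` absorbs this.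
rounds-close : ∀ {e p q a b} → 0ℚ ℚ.≤ e → Rounds e p a → Rounds e q b →
               p ℚ.≤ q ℚ.+ e → a ℕ.≤ suc b
rounds-close {e} {p} {q} {a} {b} 0≤e (a≤p , _) (_ , q<b) p≤q =
  ℕ.s≤s⁻¹ (·-cancelʳ-< a (2 ℕ.+ b) 0≤e (begin-strict
    a · e               ≤⟨ a≤p ⟩
    p ℚ.+ e             ≤⟨ ℚ.+-monoˡ-≤ e p≤q ⟩
    q ℚ.+ e ℚ.+ e       <⟨ ℚ.+-monoˡ-< e q<b ⟩
    suc b · e ℚ.+ e     ≡⟨ ℚ.+-comm (suc b · e) e ⟩
    (2 ℕ.+ b) · e       ∎))
  where open ℚ.≤-Reasoning

-- The hypothesis is what `≤⇒seq` yields for a contrast of at least `2 + d` steps: its two errors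
-- `e` consume two steps and leave `d`.
rounds-far : ∀ {e p q a b} d → 0ℚ ℚ.≤ e → Rounds e p a → Rounds e q b →
             (2 ℕ.+ d) · e ℚ.- e ℚ.≤ p ℚ.- q ℚ.+ e → d ℕ.+ b ℕ.≤ a
rounds-far {e} {p} {q} {a} {b} d 0≤e (_ , p<a) (b≤q , _) gap =
  ℕ.s≤s⁻¹ (·-cancelʳ-< (d ℕ.+ b) (suc a) 0≤e (begin-strict
    (d ℕ.+ b) · e        ≡⟨ ×-homo-+ ℚ.+-0-monoid e d b ⟩
    d · e ℚ.+ b · e      ≤⟨ ≤-by-difference
      (solve 5 (λ p q e d b → (p :- q :+ e :+ (q :+ e)) :- (e :+ (e :+ d) :- e :+ b)
                 := p :+ e :- (d :+ b)) refl p q e (d · e) (b · e))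
      (ℚ.+-mono-≤ gap b≤q) ⟩
    p ℚ.+ e              <⟨ p<a ⟩
    suc a · e            ∎))
  where
  open ℚ.≤-Reasoning
  open +-*-Solver

-- Grid cells

-- The last multiple of `p` up to `x` is not `x` itself, hence is at most `y`.
p∤x⇒x/p≤y/p : ∀ {x y} p .{{_ : NonZero p}} → ¬ p ∣ x → x ℕ.≤ suc y → x ℕ./ p ℕ.≤ y ℕ./ p
p∤x⇒x/p≤y/p {x} {y} p p∤x x≤1+y =
  subst (ℕ._≤ y ℕ./ p) (m*n/n≡m (x ℕ./ p) p)
    (/-monoˡ-≤ p (ℕ.s≤s⁻¹ (ℕ.<-≤-trans
      (ℕ.≤∧≢⇒< (m/n*n≤m x p) λ eq → p∤x (divides (x ℕ./ p) (sym eq))) x≤1+y)))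

d+x≤y⇒x/d<y/d : ∀ {x y} d .{{_ : NonZero d}} → d ℕ.+ x ℕ.≤ y → x ℕ./ d ℕ.< y ℕ./ d
d+x≤y⇒x/d<y/d {x} {y} d d+x≤y = begin-strict
  x ℕ./ d                ≤⟨ /-monoˡ-≤ d (ℕ.m+n≤o⇒m≤o∸n x (subst (ℕ._≤ y) (ℕ.+-comm d x) d+x≤y)) ⟩
  (y ℕ.∸ d) ℕ./ d        <⟨ ℕ.n<1+n _ ⟩
  suc ((y ℕ.∸ d) ℕ./ d)  ≡⟨ m/n≡1+[m∸n]/n (ℕ.m+n≤o⇒m≤o d d+x≤y) ⟨
  y ℕ./ d                ∎
  where open ℕ.≤-Reasoning

-- Otherwise each of the shifts 0 to `n` is blocked by some `v`. Two of them are blocked by the same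
-- `v`, so `p` divides their difference, which is positive and at most `n < p`.
nondividing-shift : ∀ {n} (a : Fin n → ℕ) {p} → n ℕ.< p →
                    ∃[ s ] s ℕ.≤ n × (∀ v → ¬ p ∣ a v ℕ.+ s)
nondividing-shift {n} a {p} n<p
  with Fin.any? (λ (s : Fin (suc n)) → Fin.all? λ v → ¬? (p ∣? (a v ℕ.+ toℕ s)))
... | yes (s , avoids) = toℕ s , Fin.toℕ≤pred[n] s , avoids
... | no  none =
  let i , j , i<j , eq = Fin.pigeonhole (ℕ.n<1+n n) (λ s → proj₁ (hit s))
      d                = toℕ j ℕ.∸ toℕ i
      shifted          = trans (ℕ.+-assoc (a (proj₁ (hit j))) (toℕ i) d)
                           (cong (a (proj₁ (hit j)) ℕ.+_) (ℕ.m+[n∸m]≡n (ℕ.<⇒≤ i<j)))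
      p∣d              = ∣m+n∣m⇒∣n (subst (p ∣_) (sym shifted) (proj₂ (hit j)))
                           (subst (λ v → p ∣ a v ℕ.+ toℕ i) eq (proj₂ (hit i)))
  in contradiction p∣d (>⇒∤ {{ℕ.>-nonZero (ℕ.m<n⇒0<n∸m i<j)}}
       (ℕ.≤-<-trans (ℕ.≤-trans (ℕ.m∸n≤m (toℕ j) (toℕ i)) (Fin.toℕ≤pred[n] j)) n<p))
  where
  hit : ∀ s → ∃[ v ] p ∣ a v ℕ.+ toℕ s
  hit s =
    let v , ¬¬p∣ = Fin.¬∀⟶∃¬ n (λ v → ¬ p ∣ a v ℕ.+ toℕ s) (λ v → ¬? (p ∣? _))
                     λ avoids → none (s , avoids)
    in v , decidable-stable (p ∣? _) ¬¬p∣

-- Edges and the lightest tone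

module _ {n : ℕ} (G : Graph n) where
  open Graph G

  edge-orientation : ∀ {u v} → u ~ v → (u , v) ∈ edges G ⊎ (v , u) ∈ edges G
  edge-orientation {u} {v} u~v with Fin.<-cmp u v
  ... | tri< u<v _ _  = inj₁ (∈-filter⁺ _ (∈-cartesianProduct⁺ (∈-allFin u) (∈-allFin v)) (u<v , u~v))
  ... | tri≈ _ refl _ = contradiction u~v ~-irrefl
  ... | tri> _ _ v<u  = inj₂ (∈-filter⁺ _ (∈-cartesianProduct⁺ (∈-allFin v) (∈-allFin u)) (v<u , ~-sym u~v))

  -- The lightest tone is the head of a maximal vector attained by some `g`. A contrast of `f` below
  -- it would make `cont f` smaller than `cont g`, against the maximality of `cont f`.
  lightestTone≤contrast : ∀ {t f e} → IsLightestTone G t → IsMaximumContrastGreyscale G f →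
                          e ∈ edges G → t ≤ contrast G f e
  lightestTone≤contrast {t} (x , xs , x∷xs-max , _ , t≤x) (_ , cont-max) e∈ c<t =
    let g , g-grey , cont-g≋ = IsContMax.attained x∷xs-max
    in IsContMax.maximal cont-max g g-grey
         (headBelow⇒lex {t = t} (sort-headBelow (∈-map⁺ _ e∈)) c<t t≤x cont-g≋)

-- Here k = j + 1, and range≤ is the slack that admits every shift s ≤ n.
module Cells {n : ℕ} (G : Graph n) (j : ℕ) (lt : IsLightestTone G (fromℚ (+ 1 / suc j)))
             {f : Fin n → ℝ} (f-max : IsMaximumContrastGreyscale G f)
             {p m : ℕ} .{{_ : NonZero p}} (1+m≡ : suc m ≡ suc j ℕ.* (2 ℕ.+ p)) (n<p : n ℕ.< p)
             (range≤ : 4 ℕ.+ m ℕ.+ n ℕ.≤ (2 ℕ.+ j) ℕ.* p) where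
  open Graph G
  open IsGreyscale (proj₁ f-max)

  -- contrast reads tones at index N when it is evaluated at index m
  N : ℕ
  N = suc (m ℕ.+ m)

  e : ℚ
  e = ε m

  e≥0 : 0ℚ ℚ.≤ e
  e≥0 = 0≤ε m

  tone : Fin n → ℚ
  tone v = seq (f v) N

  1≡ : suc m · e ≡ 1ℚ
  1≡ = ·-ε-scale (suc m) 0 m (sym (ℕ.*-identityˡ (suc m)))

  1/k≡ : (2 ℕ.+ p) · e ≡ + 1 / suc j
  1/k≡ = ·-ε-scale (2 ℕ.+ p) j m 1+m≡

  -- The errors `ε N` on the two sides add up to exactly one step `e`.
  ≤⇒tone : ∀ {x y} → x ≤ y → seq x N ℚ.≤ seq y N ℚ.+ e
  ≤⇒tone {x} {y} x≤y = ≤-by-difference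
    (trans (solve 3 (λ a b h → b :+ h :- (a :- h) := b :+ (h :+ h) :- a) refl (seq x N) (seq y N) (ε N))
           (cong (λ e → seq y N ℚ.+ e ℚ.- seq x N) (ε-half m)))
    (≤⇒seq {x} {y} x≤y N)
    where open +-*-Solver

  -- Of the steps, `m + 1` make up 1, one is the error, one the shift in `Rounds`, and one makes the
  -- bound strict.
  tone+e<4+m : ∀ v → tone v ℚ.+ e ℚ.< (4 ℕ.+ m) · e
  tone+e<4+m v = begin-strict
    tone v ℚ.+ e              ≤⟨ ℚ.+-monoˡ-≤ e (≤⇒tone {f v} {1ℝ} (≤one v)) ⟩
    1ℚ ℚ.+ e ℚ.+ e            ≡⟨ cong (λ x → x ℚ.+ e ℚ.+ e) 1≡ ⟨
    suc m · e ℚ.+ e ℚ.+ e     <⟨ <-by-difference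
      (solve 2 (λ x e → e :- con 0ℚ := (e :+ (e :+ (e :+ x))) :- (x :+ e :+ e)) refl (suc m · e) e)
      (ε>0 m) ⟩
    (4 ℕ.+ m) · e             ∎
    where
    open ℚ.≤-Reasoning
    open +-*-Solver

  -- abstract, because unfolding the search in floor makes type checking infeasible
  abstract
    rounding : ∀ v → ∃[ a ] Rounds e (tone v) a
    rounding v =
      let a , a≤ , <1+a = floor (4 ℕ.+ m) (≤⇒tone {0ℝ} {f v} (nonneg v)) (tone+e<4+m v)
      in a , (a≤ , <1+a)

  a : Fin n → ℕ
  a v = proj₁ (rounding v)

  a<4+m : ∀ v → a v ℕ.< 4 ℕ.+ m
  a<4+m v = ·-cancelʳ-< (a v) (4 ℕ.+ m) e≥0
    (ℚ.≤-<-trans (Rounds.lower (proj₂ (rounding v))) (tone+e<4+m v))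

  abstract
    shift : ∃[ s ] s ℕ.≤ n × (∀ v → ¬ p ∣ a v ℕ.+ s)
    shift = nondividing-shift a n<p

  s : ℕ
  s = proj₁ shift

  cell : Fin n → ℕ
  cell v = (a v ℕ.+ s) ℕ./ p

  cell<1+k : ∀ v → cell v ℕ.< 2 ℕ.+ j
  cell<1+k v = m<n*o⇒m/o<n {n = 2 ℕ.+ j} (begin-strict
    a v ℕ.+ s              <⟨ ℕ.+-mono-<-≤ (a<4+m v) (proj₁ (proj₂ shift)) ⟩
    4 ℕ.+ m ℕ.+ n          ≤⟨ range≤ ⟩
    (2 ℕ.+ j) ℕ.* p        ∎)
    where open ℕ.≤-Reasoning

  colour : Fin n → Fin (2 ℕ.+ j)
  colour v = fromℕ< (cell<1+k v)

  colour≡⇒cell≡ : ∀ u v → colour u ≡ colour v → cell u ≡ cell v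
  colour≡⇒cell≡ u v eq =
    trans (sym (Fin.toℕ-fromℕ< (cell<1+k u))) (trans (cong toℕ eq) (Fin.toℕ-fromℕ< (cell<1+k v)))

  -- Even if `a u` exceeds `a v` by one, no boundary separates them, as `a u + s` is not a multiple
  -- of `p`. Hence equal tones share a cell even when their roundings differ.
  cell-mono : ∀ {u v} → f u ≤ f v → cell u ℕ.≤ cell v
  cell-mono {u} {v} fu≤fv = p∤x⇒x/p≤y/p p (proj₂ (proj₂ shift) u)
    (ℕ.+-monoˡ-≤ s (rounds-close e≥0 (proj₂ (rounding u)) (proj₂ (rounding v))
      (≤⇒tone {f u} {f v} fu≤fv)))

  obtained : IsObtainedFrom G f colour
  obtained u v (fu≤fv , fv≤fu) =
    Fin.fromℕ<-cong _ _ (ℕ.≤-antisym (cell-mono fu≤fv) (cell-mono fv≤fu)) _ _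

  far⇒cell< : ∀ {u v} → (2 ℕ.+ p) · e ℚ.- e ℚ.≤ tone u ℚ.- tone v ℚ.+ e → cell v ℕ.< cell u
  far⇒cell< {u} {v} gap = d+x≤y⇒x/d<y/d p
    (subst (ℕ._≤ a u ℕ.+ s) (ℕ.+-assoc p (a v) s)
      (ℕ.+-monoˡ-≤ s (rounds-far p e≥0 (proj₂ (rounding u)) (proj₂ (rounding v)) gap)))

  -- The variable `x` lets either sign of the difference stand for its absolute value.
  contrast-gap : ∀ {u v x} → (u , v) ∈ edges G → ℚ.∣ tone u ℚ.- tone v ∣ ≡ x →
                 (2 ℕ.+ p) · e ℚ.- e ℚ.≤ x ℚ.+ e
  contrast-gap {u} {v} uv∈ refl = subst (λ t → t ℚ.- e ℚ.≤ _) (sym 1/k≡)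
    (≤⇒seq {fromℚ (+ 1 / suc j)} {contrast G f (u , v)}
      (lightestTone≤contrast G {fromℚ (+ 1 / suc j)} {f} lt f-max uv∈) m)

  edge⇒cell≢ : ∀ {u v} → (u , v) ∈ edges G → cell u ≢ cell v
  edge⇒cell≢ {u} {v} uv∈ same =
    [ (λ eq → ℕ.<⇒≢ (far⇒cell< {u} {v} (contrast-gap uv∈ eq)) (sym same))
    , (λ eq → ℕ.<⇒≢ (far⇒cell< {v} {u}
        (contrast-gap uv∈ (trans eq (-[a-b]≡b-a (tone u) (tone v))))) same)
    ]′ (ℚ.∣p∣≡p∨∣p∣≡-p (tone u ℚ.- tone v))

  proper : IsColouring G colour
  proper {u} {v} u~v same =
    [ (λ uv∈ → edge⇒cell≢ uv∈ (colour≡⇒cell≡ u v same))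
    , (λ vu∈ → edge⇒cell≢ vu∈ (sym (colour≡⇒cell≡ u v same)))
    ]′ (edge-orientation G u~v)

theorem3p4 : ∀ {n : ℕ} (G : Graph n) → Connected G →
    (k : ℕ) .{{_ : NonZero k}} → IsLightestTone G (fromℚ (+ 1 / k)) →
    (f : Fin n → ℝ) → IsMaximumContrastGreyscale G f →
    Σ[ c ∈ (Fin n → Fin (suc k)) ] IsColouring G c × IsObtainedFrom G f c
theorem3p4 {n} G _ k@(suc j) lt f f-max = colour , proper , obtained
  where
  open ℕ-Solver
  p : ℕ
  -- With `1 + m = k(p + 2)`, the bound `4 + m + n ≤ (k + 1)p` amounts to `3 + 2k + n ≤ p`; this is
  -- the least such `p`.
  p = 3 ℕ.+ (2 ℕ.* k ℕ.+ n)
  -- The left side is `4 + m + n`, where `m` unfolds to `1 + p + j(2 + p)`.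
  range : ∀ j n → let p = 3 ℕ.+ (2 ℕ.* suc j ℕ.+ n) in
          5 ℕ.+ (p ℕ.+ j ℕ.* (2 ℕ.+ p)) ℕ.+ n ≡ (2 ℕ.+ j) ℕ.* p
  range = solve 2 (λ j n → let p = con 3 :+ (con 2 :* (con 1 :+ j) :+ n) in
    con 5 :+ (p :+ j :* (con 2 :+ p)) :+ n := (con 2 :+ j) :* p) refl
  open Cells G j lt f-max {p} refl (ℕ.s≤s (ℕ.m≤n⇒m≤o+n 2 (ℕ.m≤n+m n (2 ℕ.* k))))
    (ℕ.≤-reflexive (range j n))
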